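{- Let $G$ be a finite simple graph. Then $G$ is connected (as a graph) if and only if $B(G)$ with the star topology is connected (as a topological space).
   Context: Graphs are finite and simple: $G=(V(G),E(G))$ with $E(G)$ a set of 2-element subsets of $V(G)$. A graph is connected if there is a path between any pair of its vertices. The bare representation $B(G)$ is the disjoint union $V(G)\sqcup E(G)$. The open star of $v\in V(G)$ is $S_G(v)=\{v\}\cup\{e\in E(G): e \text{ is incident to } v\}\subseteq B(G)$. The star topology on $B(G)$ is the topology generated by the sub-basis $\{S_G(v):v\in V(G)\}$. A topological space is connected if it cannot be written as the union of two disjoint non-empty open sets. -}

module Defs where

open import Data.Bool using (Bool; T)
open import Data.Fin using (Fin)
open import Data.Fin.Subset using (Subset; ⁅_⁆; ∣_∣) renaming (_∈_ to _∈ₛ_; _∪_ to _∪ₛ_)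
open import Data.List using (List; []; _∷_)
open import Data.List.Relation.Unary.Unique.Propositional using (Unique)
open import Data.Nat using (ℕ)
open import Data.Product using (Σ-syntax; _×_; _,_)
open import Data.Sum using (_⊎_; inj₁; inj₂)
open import Level using (0ℓ)
open import Relation.Binary.Construct.Closure.ReflexiveTransitive using (Star; ε; _◅_)
open import Relation.Binary.PropositionalEquality using (_≡_)
open import Relation.Nullary using (¬_)
open import Relation.Unary using (Pred; U; Empty; Satisfiable; Universal; _≐_; _∩_; _∪_; ⋃)

-- The edge set is a set of 2-element subsets of the vertex set Fin order.
-- It is given by its Boolean characteristic function, so that each edge is
-- a point of Edge exactly once (T b has at most one proof).
record Graph : Set where
  field
    order     : ℕ
    isEdge    : Subset order → Bool
    edge-size : ∀ e → T (isEdge e) → ∣ e ∣ ≡ 2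

  Vertex : Set
  Vertex = Fin order

  Edge : Set
  Edge = Σ[ e ∈ Subset order ] T (isEdge e)

  -- Since ∣ ⁅ v ⁆ ∪ₛ ⁅ v ⁆ ∣ is 1, edge-size makes this irreflexive.
  Adjacent : Vertex → Vertex → Set
  Adjacent u v = T (isEdge (⁅ u ⁆ ∪ₛ ⁅ v ⁆))

  Walk : Vertex → Vertex → Set
  Walk = Star Adjacent

  vertices : ∀ {u v} → Walk u v → List Vertex
  vertices {u} ε       = u ∷ []
  vertices {u} (_ ◅ w) = u ∷ vertices w

  Path : Vertex → Vertex → Set
  Path u v = Σ[ w ∈ Walk u v ] Unique (vertices w)

  ConnectedGraph : Set
  ConnectedGraph = ∀ u v → Path u v

-- Subsets are predicates, considered up to mutual inclusion _≐_.  Openness of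
-- the empty set is open-⋃ for the empty family.
record TopologicalSpace : Set₂ where
  field
    Point  : Set
    Open   : Pred Point 0ℓ → Set₁
    open-≐ : ∀ {P Q} → P ≐ Q → Open P → Open Q
    open-U : Open U
    open-∩ : ∀ {P Q} → Open P → Open Q → Open (P ∩ Q)
    open-⋃ : ∀ (I : Set) (P : I → Pred Point 0ℓ) → (∀ i → Open (P i)) → Open (⋃ I P)

open TopologicalSpace using (Point; Open)

Separation : (X : TopologicalSpace) → Pred (Point X) 0ℓ → Pred (Point X) 0ℓ → Set₁
Separation X P Q =
  Open X P × Open X Q ×
  Satisfiable P × Satisfiable Q ×
  Empty (P ∩ Q) × Universal (P ∪ Q)

ConnectedSpace : TopologicalSpace → Set₁
ConnectedSpace X = ¬ (Σ[ P ∈ Pred (Point X) 0ℓ ] Σ[ Q ∈ Pred (Point X) 0ℓ ] Separation X P Q)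

-- The smallest topology on X in which every S j is open.
data GeneratedOpen {X J : Set} (S : J → Pred X 0ℓ) : Pred X 0ℓ → Set₁ where
  sub-basic : ∀ j → GeneratedOpen S (S j)
  ext       : ∀ {P Q} → P ≐ Q → GeneratedOpen S P → GeneratedOpen S Q
  whole     : GeneratedOpen S U
  inter     : ∀ {P Q} → GeneratedOpen S P → GeneratedOpen S Q → GeneratedOpen S (P ∩ Q)
  union     : ∀ (I : Set) (P : I → Pred X 0ℓ) →
              (∀ i → GeneratedOpen S (P i)) → GeneratedOpen S (⋃ I P)

generatedBy : {X J : Set} → (J → Pred X 0ℓ) → TopologicalSpace
generatedBy {X} S = record
  { Point  = X
  ; Open   = GeneratedOpen S
  ; open-≐ = ext
  ; open-U = whole
  ; open-∩ = inter
  ; open-⋃ = union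
  }

module _ (G : Graph) where
  open Graph G

  BareRepresentation : Set
  BareRepresentation = Vertex ⊎ Edge

  openStar : Vertex → Pred BareRepresentation 0ℓ
  openStar v (inj₁ w)       = w ≡ v
  openStar v (inj₂ (e , _)) = v ∈ₛ e

  starTopology : TopologicalSpace
  starTopology = generatedBy openStar

{-# OPTIONS --safe #-}
-- An open set of the star topology that contains a vertex contains its whole
-- star, hence every edge at it.  So the part of a separation that contains a
-- vertex also contains every vertex reachable from it, and the part that
-- contains an edge contains its endpoints.  Conversely, the union of the stars
-- of the vertices reachable from u and the union of the other stars form a
-- separation as soon as some vertex is not reachable.  Constructively, a path
-- is recovered from the absence of a separation because reachability is
-- decidable: loop erasure bounds the length of the walks to be searched.
module Submission where

open import Defs
open import Function.Bundles using (_⇔_; mk⇔)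

open import Data.Bool using (T; T?)
open import Data.Fin using (zero; suc)
open import Data.Fin.Properties using (_≟_; any?; injective⇒≤)
open import Data.Fin.Subset using (Subset; ⁅_⁆; ∣_∣; Nonempty)
  renaming (_∈_ to _∈ₛ_; _∪_ to _∪ₛ_; _⊆_ to _⊆ₛ_; _⊂_ to _⊂ₛ_)
open import Data.Fin.Subset.Properties
  using (_∈?_; nonempty?; Empty-unique; ∣⊥∣≡0; ∣⁅x⁆∣≡1; x∈⁅x⁆; x∈⁅y⁆⇒x≡y;
         x∈p∪q⁺; x∈p∪q⁻; p⊆p∪q; p⊂q⇒∣p∣<∣q∣; ⊆-antisym)
open import Data.List using (List; length; lookup)
open import Data.List.Membership.Propositional using (_∈_)
open import Data.List.Membership.Propositional.Properties using (∈-lookup)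
import Data.List.Membership.DecPropositional as DecMembership
open import Data.List.Relation.Unary.All as All using ([]; _∷_)
open import Data.List.Relation.Unary.All.Properties using (¬Any⇒All¬)
open import Data.List.Relation.Unary.AllPairs using ([]; _∷_)
open import Data.List.Relation.Unary.Any using (here; there)
open import Data.List.Relation.Unary.Unique.Propositional using (Unique)
open import Data.Nat using (ℕ; zero; suc; _≤_; _<_; z≤n; s≤s)
open import Data.Nat.Properties using (<-≤-trans; n≮n)
open import Data.Product using (Σ-syntax; ∃-syntax; _,_; proj₁; proj₂)
open import Data.Sum using (inj₁; inj₂; swap)
open import Function using (Injective)
open import Level using (0ℓ)
open import Relation.Binary.Construct.Closure.ReflexiveTransitive using (ε; _◅_; _▻▻_)
open import Relation.Binary.PropositionalEquality using (_≡_; _≢_; refl; sym; trans; cong; subst)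
open import Relation.Nullary using (¬_; Dec; yes; no; contradiction)
open import Relation.Nullary.Decidable using (map′; _×-dec_)
open import Relation.Unary using (Pred; Empty; Universal; _∩_; _∪_; ⋃)

-- For vertex lists this embeds the positions into `Fin order`, which bounds the length of a
-- duplicate-free list by `order`.
lookup-injective : {A : Set} {xs : List A} → Unique xs → Injective _≡_ _≡_ (lookup xs)
lookup-injective (_  ∷ _) {zero}  {zero}  _  = refl
lookup-injective (x∉ ∷ _) {zero}  {suc j} eq = contradiction eq (All.lookup x∉ (∈-lookup j))
lookup-injective (x∉ ∷ _) {suc i} {zero}  eq = contradiction (sym eq) (All.lookup x∉ (∈-lookup i))
lookup-injective (_  ∷ u) {suc i} {suc j} eq = cong suc (lookup-injective u eq)

module _ {n : ℕ} {e : Subset n} (∣e∣≡2 : ∣ e ∣ ≡ 2) where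

  pair-nonempty : Nonempty e
  pair-nonempty with nonempty? e
  ... | yes ne = ne
  ... | no  em = contradiction (trans (sym ∣e∣≡2) (trans (cong ∣_∣ (Empty-unique em)) (∣⊥∣≡0 n))) λ ()

  -- A further element of e would give a strict chain ⁅ a ⁆ ⊂ ⁅ a ⁆ ∪ ⁅ b ⁆ ⊂ e,
  -- which is too long for ∣ e ∣ ≡ 2.
  pair-of-members : ∀ {a b} → a ≢ b → a ∈ₛ e → b ∈ₛ e → ⁅ a ⁆ ∪ₛ ⁅ b ⁆ ≡ e
  pair-of-members {a} {b} a≢b a∈e b∈e = ⊆-antisym ab⊆e e⊆ab
    where
    ab⊆e : ⁅ a ⁆ ∪ₛ ⁅ b ⁆ ⊆ₛ e
    ab⊆e x∈ab with x∈p∪q⁻ ⁅ a ⁆ ⁅ b ⁆ x∈ab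
    ... | inj₁ x∈a rewrite x∈⁅y⁆⇒x≡y a x∈a = a∈e
    ... | inj₂ x∈b rewrite x∈⁅y⁆⇒x≡y b x∈b = b∈e

    a⊂ab : ⁅ a ⁆ ⊂ₛ ⁅ a ⁆ ∪ₛ ⁅ b ⁆
    a⊂ab = p⊆p∪q ⁅ b ⁆ , b , x∈p∪q⁺ (inj₂ (x∈⁅x⁆ b)) ,
           λ b∈a → a≢b (sym (x∈⁅y⁆⇒x≡y a b∈a))

    1<∣ab∣ : 1 < ∣ ⁅ a ⁆ ∪ₛ ⁅ b ⁆ ∣
    1<∣ab∣ = subst (_< ∣ ⁅ a ⁆ ∪ₛ ⁅ b ⁆ ∣) (∣⁅x⁆∣≡1 a) (p⊂q⇒∣p∣<∣q∣ a⊂ab)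

    e⊆ab : e ⊆ₛ ⁅ a ⁆ ∪ₛ ⁅ b ⁆
    e⊆ab {x} x∈e with x ∈? ⁅ a ⁆ ∪ₛ ⁅ b ⁆
    ... | yes x∈ab = x∈ab
    ... | no  x∉ab = contradiction
      (<-≤-trans (subst (∣ ⁅ a ⁆ ∪ₛ ⁅ b ⁆ ∣ <_) ∣e∣≡2 (p⊂q⇒∣p∣<∣q∣ (ab⊆e , x , x∈e , x∉ab)))
                 1<∣ab∣)
      (n≮n _)

module _ (G : Graph) where
  open Graph G
  open DecMembership (_≟_ {order}) using () renaming (_∈?_ to _∈ₗ?_)

  adjacent? : ∀ u v → Dec (Adjacent u v)
  adjacent? u v = T? _

  suffix : ∀ {x u v} (w : Walk x v) → Unique (vertices w) → u ∈ vertices w → Path u v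
  suffix ε       uniq       (here refl) = ε , uniq
  suffix (a ◅ w) uniq       (here refl) = a ◅ w , uniq
  suffix (_ ◅ w) (_ ∷ uniq) (there u∈w) = suffix w uniq u∈w

  -- The tail is made loop-free first. If `u` recurs there, the part from that occurrence on
  -- replaces the whole walk; otherwise prepending `u` keeps the vertices distinct.
  loop-erasure : ∀ {u v} → Walk u v → Path u v
  loop-erasure ε = ε , [] ∷ []
  loop-erasure {u} (a ◅ w) with loop-erasure w
  ... | w′ , uniq with u ∈ₗ? vertices w′
  ...   | yes u∈w′ = suffix w′ uniq u∈w′
  ...   | no  u∉w′ = a ◅ w′ , ¬Any⇒All¬ _ u∉w′ ∷ uniq

  -- The bound counts vertices rather than edges: a duplicate-free walk then fits within `order`,
  -- and no walk fits within `0`.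
  WalkWithin : ℕ → Vertex → Vertex → Set
  WalkWithin k u v = Σ[ w ∈ Walk u v ] length (vertices w) ≤ k

  walkWithin? : ∀ k u v → Dec (WalkWithin k u v)
  walkWithin? zero u v = no λ { (ε , ()) ; (_ ◅ _ , ()) }
  walkWithin? (suc k) u v with u ≟ v
  ... | yes refl = yes (ε , s≤s z≤n)
  ... | no  u≢v  = map′
    (λ { (_ , a , w , le) → a ◅ w , s≤s le })
    (λ { (ε , _) → contradiction refl u≢v ; (a ◅ w , s≤s le) → _ , a , w , le })
    (any? λ x → adjacent? u x ×-dec walkWithin? k x v)

  walk? : ∀ u v → Dec (Walk u v)
  walk? u v = map′ proj₁ shorten (walkWithin? order u v)
    where
    shorten : Walk u v → WalkWithin order u v
    shorten w with loop-erasure w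
    ... | w′ , uniq = w′ , injective⇒≤ (lookup-injective uniq)

  endpoint : ((e , _) : Edge) → ∃[ v ] v ∈ₛ e
  endpoint (e , isE) = pair-nonempty (edge-size e isE)

  -- Induction on how the open set is generated. The sub-basic case rests on a vertex lying in no
  -- star but its own.
  open-contains-star : ∀ {P} → GeneratedOpen (openStar G) P →
                       ∀ {v} → P (inj₁ v) → ((e , isE) : Edge) → v ∈ₛ e → P (inj₂ (e , isE))
  open-contains-star (sub-basic _) refl e v∈e = v∈e
  open-contains-star (ext (P⊆Q , Q⊆P) o) p e v∈e = P⊆Q (open-contains-star o (Q⊆P p) e v∈e)
  open-contains-star whole p e v∈e = _
  open-contains-star (inter o o′) (p , q) e v∈e =
    open-contains-star o p e v∈e , open-contains-star o′ q e v∈e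
  open-contains-star (union I P o) (i , p) e v∈e = i , open-contains-star (o i) p e v∈e

  module _ {P Q : Pred (BareRepresentation G) 0ℓ}
           (oP : GeneratedOpen (openStar G) P) (oQ : GeneratedOpen (openStar G) Q)
           (disjoint : Empty (P ∩ Q)) (cover : Universal (P ∪ Q)) where

    -- Otherwise `v` would lie in `Q`, and openness of `Q` would pull `e` into `Q` as well.
    edge⇒endpoint : ((e , isE) : Edge) → P (inj₂ (e , isE)) → ∀ {v} → v ∈ₛ e → P (inj₁ v)
    edge⇒endpoint e p {v} v∈e with cover (inj₁ v)
    ... | inj₁ p′ = p′
    ... | inj₂ q  = contradiction (p , open-contains-star oQ q e v∈e) (disjoint _)

    part-has-vertex : ∀ {x} → P x → ∃[ v ] P (inj₁ v)
    part-has-vertex {inj₁ v} p = v , p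
    part-has-vertex {inj₂ e} p with endpoint e
    ... | v , v∈e = v , edge⇒endpoint e p v∈e

    part-closed-under-walks : ∀ {u v} → Walk u v → P (inj₁ u) → P (inj₁ v)
    part-closed-under-walks ε p = p
    part-closed-under-walks {u} (_◅_ {j = x} a w) p =
      part-closed-under-walks w
        -- Openness of `P` carries membership from `u` to the edge; openness of `Q` then keeps the
        -- far endpoint `x` in `P`.
        (edge⇒endpoint (_ , a) (open-contains-star oP p (_ , a) (x∈p∪q⁺ (inj₁ (x∈⁅x⁆ u))))
                       (x∈p∪q⁺ (inj₂ (x∈⁅x⁆ x))))

  connectedGraph⇒connectedSpace : ConnectedGraph → ConnectedSpace (starTopology G)
  connectedGraph⇒connectedSpace conn (P , Q , oP , oQ , (_ , p) , (_ , q) , disjoint , cover)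
    with part-has-vertex oP oQ disjoint cover p
       | part-has-vertex oQ oP (λ x (q , p) → disjoint x (p , q)) (λ x → swap (cover x)) q
  ... | u , Pu | v , Qv =
    disjoint _ (part-closed-under-walks oP oQ disjoint cover (proj₁ (conn u v)) Pu , Qv)

  starsOf : (Vertex → Set) → Pred (BareRepresentation G) 0ℓ
  starsOf R = ⋃ (Σ[ v ∈ Vertex ] R v) λ (v , _) → openStar G v

  starsOf-open : ∀ R → GeneratedOpen (openStar G) (starsOf R)
  starsOf-open R = union _ _ λ (v , _) → sub-basic v

  unreachable⇒separation : ∀ {u v} → ¬ Walk u v →
    Separation (starTopology G) (starsOf (Walk u)) (starsOf λ x → ¬ Walk u x)
  unreachable⇒separation {u} {v} ¬w =
    starsOf-open _ , starsOf-open _ ,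
    (inj₁ u , (u , ε) , refl) , (inj₁ v , (v , ¬w) , refl) , disjoint , cover
    where
    disjoint : Empty (starsOf (Walk u) ∩ starsOf λ x → ¬ Walk u x)
    disjoint (inj₁ _) (((_ , w) , refl) , ((_ , ¬w) , refl)) = ¬w w
    -- One of `a`, `b` is reachable and the other is not, so they differ and `e` joins them.
    -- Appending `e` to `w` would reach `b`.
    disjoint (inj₂ (e , isE)) (((a , w) , a∈e) , ((b , ¬w) , b∈e)) =
      ¬w ((subst (λ p → T (isEdge p)) (sym ab≡e) isE ◅ ε) ▻▻ w)
      where
      ab≡e : ⁅ a ⁆ ∪ₛ ⁅ b ⁆ ≡ e
      ab≡e = pair-of-members (edge-size e isE) (λ { refl → ¬w w }) a∈e b∈e

    -- Covering requires deciding on which side each point falls; `walk?` at the centre of a star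
    -- containing the point settles it.
    star-covered : ∀ x y → openStar G x y → (starsOf (Walk u) ∪ starsOf λ z → ¬ Walk u z) y
    star-covered x _ x∋y with walk? u x
    ... | yes w = inj₁ ((x , w) , x∋y)
    ... | no ¬w = inj₂ ((x , ¬w) , x∋y)

    cover : Universal (starsOf (Walk u) ∪ starsOf λ x → ¬ Walk u x)
    cover (inj₁ x) = star-covered x (inj₁ x) refl
    cover (inj₂ e) with endpoint e
    ... | x , x∈e = star-covered x (inj₂ e) x∈e

  connectedSpace⇒connectedGraph : ConnectedSpace (starTopology G) → ConnectedGraph
  connectedSpace⇒connectedGraph conn u v with walk? u v
  ... | yes w = loop-erasure w
  ... | no ¬w = contradiction
    (starsOf (Walk u) , starsOf (λ x → ¬ Walk u x) , unreachable⇒separation ¬w) conn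

theorem3p10 : (G : Graph) → Graph.ConnectedGraph G ⇔ ConnectedSpace (starTopology G)
theorem3p10 G = mk⇔ (connectedGraph⇒connectedSpace G) (connectedSpace⇒connectedGraph G)
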